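{- For each positive integer $r$ there exist nonzero integers $a_{2r-1}$ and $b_r$, not depending on $n$, such that for every positive integer $n$, $$a_{2r-1}\sum_{k=0}^{n-1}S_k^{(2r-1)}\equiv 0\pmod{n^2}\quad\text{and}\quad b_r\sum_{k=0}^{n-1}kS_k^{(r)}\equiv 0\pmod{n^2},$$ where $S_m^{(s)}=\sum_{k=0}^{m}\binom{m}{k}^2\binom{2k}{k}(2k+1)^{s}$. -}

module Defs where

open import Data.Nat using (ℕ; zero; suc; _+_; _*_; _^_)
open import Data.Nat.Combinatorics using (_C_)

sumTo : ℕ → (ℕ → ℕ) → ℕ
sumTo zero    f = f 0
sumTo (suc m) f = sumTo m f + f (suc m)

sumBelow : ℕ → (ℕ → ℕ) → ℕ
sumBelow zero    f = 0
sumBelow (suc n) f = sumBelow n f + f n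

S : ℕ → ℕ → ℕ
S s m = sumTo m (λ k → (m C k) * (m C k) * ((2 * k) C k) * (2 * k + 1) ^ s)

{-# OPTIONS --safe #-}
module Submission where

-- Summing over m first, T_k = Σ_{m<n} C(m,k)² is not hypergeometric, but it satisfies the
-- first order recurrence
--   (k+1) T_k + 2n C(n,k+1)² = 2(2k+3) T_{k+1} + 3(k+1) C(n,k+1)².
-- Since (k+1) C(n,k+1) = n C(n-1,k), the weights w_k = C(2k,k)(2k+1) T_k therefore satisfy
-- (k+1) w_k ≡ (k+1) w_{k+1} (mod n²), and w_n = 0.  Summation by parts turns
-- Σ_k w_k (2k+1)^s into Σ_k (w_k - w_{k+1}) Σ_{i≤k} (2i+1)^s, and some nonzero multiple of
-- the inner sum, independent of k, is divisible by k+1.  This settles every positive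
-- exponent, odd or even.  The weighted sum reduces to it through
--   4 Σ_m m S_m^(r) + 3 Σ_m S_m^(r) ≡ Σ_m S_m^(r+1) (mod n²).

open import Defs
open import Data.Nat using (ℕ; zero; suc; _+_; _*_; _^_; _∸_; _≤_; _<_;
  NonZero; ≢-nonZero⁻¹)
open import Data.Nat.Properties
open import Data.Nat.Combinatorics
  using (_C_; nC1≡n; nCk≡nC[n∸k]; nCk+nC[k+1]≡[n+1]C[k+1]; k>n⇒nCk≡0)
open import Data.Nat.Divisibility as ℕ∣
  using (divides; ∣m+n∣m⇒∣n; ∣m∣n⇒∣m+n; ∣n⇒∣m*n; m∣m*n)
open import Data.Nat.Tactic.RingSolver using (solve-∀)
open import Data.Integer using (ℤ; +_; 0ℤ)
open import Data.Integer.Divisibility using (_∣_)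
open import Data.Integer.Properties using (+-injective; abs-*)
open import Data.Product using (Σ; _×_; _,_)
open import Relation.Binary.PropositionalEquality
  using (_≡_; _≢_; refl; sym; trans; cong; cong₂; subst; module ≡-Reasoning)

open ≡-Reasoning

-- Congruences between natural numbers.

infix 4 _≡_[mod_]

-- Multiples of `q` are added on both sides, so that differences of either sign are covered without
-- subtraction and every proof stays in the semiring of natural numbers.
record _≡_[mod_] (a b q : ℕ) : Set where
  constructor congruent
  field
    x y : ℕ
    balance : a + q * x ≡ b + q * y

≡⇒≡mod : ∀ {q a b} → a ≡ b → a ≡ b [mod q ]
≡⇒≡mod refl = congruent 0 0 refl

≡mod-trans : ∀ {q a b c} → a ≡ b [mod q ] → b ≡ c [mod q ] → a ≡ c [mod q ]
≡mod-trans {q} {a} {b} {c} (congruent x y p) (congruent x′ y′ p′) = congruent (x + x′) (y + y′) (begin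
  a + q * (x + x′)      ≡⟨ expand a q x x′ ⟩
  (a + q * x) + q * x′  ≡⟨ cong (_+ q * x′) p ⟩
  (b + q * y) + q * x′  ≡⟨ swap b q y x′ ⟩
  (b + q * x′) + q * y  ≡⟨ cong (_+ q * y) p′ ⟩
  (c + q * y′) + q * y  ≡⟨ collect c q y y′ ⟩
  c + q * (y + y′)      ∎)
  where
  expand : ∀ a q x x′ → a + q * (x + x′) ≡ (a + q * x) + q * x′
  expand = solve-∀
  swap : ∀ b q y x′ → (b + q * y) + q * x′ ≡ (b + q * x′) + q * y
  swap = solve-∀
  collect : ∀ c q y y′ → (c + q * y′) + q * y ≡ c + q * (y + y′)
  collect = solve-∀

≡mod-+ : ∀ {q a b c d} → a ≡ b [mod q ] → c ≡ d [mod q ] → a + c ≡ b + d [mod q ]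
≡mod-+ {q} {a} {b} {c} {d} (congruent x y p) (congruent x′ y′ p′) =
  congruent (x + x′) (y + y′)
    (trans (rearrange a c q x x′) (trans (cong₂ _+_ p p′) (sym (rearrange b d q y y′))))
  where
  rearrange : ∀ a c q x x′ → (a + c) + q * (x + x′) ≡ (a + q * x) + (c + q * x′)
  rearrange = solve-∀

≡mod-*ˡ : ∀ {q a b} c → a ≡ b [mod q ] → c * a ≡ c * b [mod q ]
≡mod-*ˡ {q} {a} {b} c (congruent x y p) =
  congruent (c * x) (c * y)
    (trans (factor c a q x) (trans (cong (c *_) p) (sym (factor c b q y))))
  where
  factor : ∀ c a q x → c * a + q * (c * x) ≡ c * (a + q * x)
  factor = solve-∀

∣-≡mod : ∀ {q a b} → a ≡ b [mod q ] → q ℕ∣.∣ b → q ℕ∣.∣ a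
∣-≡mod {q} {a} {b} (congruent x y p) q∣b =
  ∣m+n∣m⇒∣n
    (subst (q ℕ∣.∣_) (trans (sym p) (+-comm a (q * x))) (∣m∣n⇒∣m+n q∣b (m∣m*n y))) (m∣m*n x)

-- Finite sums and exchange of summation.

sumBelow-cong : ∀ n {f g} → (∀ k → f k ≡ g k) → sumBelow n f ≡ sumBelow n g
sumBelow-cong zero    f≡g = refl
sumBelow-cong (suc n) f≡g = cong₂ _+_ (sumBelow-cong n f≡g) (f≡g n)

sumBelow-+ : ∀ n f g → sumBelow n (λ k → f k + g k) ≡ sumBelow n f + sumBelow n g
sumBelow-+ zero    f g = refl
sumBelow-+ (suc n) f g =
  trans (cong (_+ (f n + g n)) (sumBelow-+ n f g))
    (interchange (sumBelow n f) (sumBelow n g) (f n) (g n))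
  where
  interchange : ∀ a b c d → (a + b) + (c + d) ≡ (a + c) + (b + d)
  interchange = solve-∀

sumBelow-*ˡ : ∀ n c f → sumBelow n (λ k → c * f k) ≡ c * sumBelow n f
sumBelow-*ˡ zero    c f = sym (*-zeroʳ c)
sumBelow-*ˡ (suc n) c f =
  trans (cong (_+ c * f n) (sumBelow-*ˡ n c f)) (sym (*-distribˡ-+ c (sumBelow n f) (f n)))

sumBelow-zero : ∀ n {f} → (∀ k → k < n → f k ≡ 0) → sumBelow n f ≡ 0
sumBelow-zero zero    f≡0 = refl
sumBelow-zero (suc n) f≡0 =
  cong₂ _+_ (sumBelow-zero n (λ k k<n → f≡0 k (m<n⇒m<1+n k<n))) (f≡0 n (n<1+n n))

sumBelow-≡mod : ∀ {q} n {f g} → (∀ k → f k ≡ g k [mod q ]) → sumBelow n f ≡ sumBelow n g [mod q ]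
sumBelow-≡mod zero    f≡g = ≡⇒≡mod refl
sumBelow-≡mod (suc n) f≡g = ≡mod-+ (sumBelow-≡mod n f≡g) (f≡g n)

sumTo≡sumBelow : ∀ m f → sumTo m f ≡ sumBelow (suc m) f
sumTo≡sumBelow zero    f = refl
sumTo≡sumBelow (suc m) f = cong (_+ f (suc m)) (sumTo≡sumBelow m f)

-- Since `f` vanishes above the diagonal, each row may be extended to full length, and the order of
-- summation in the resulting square can be exchanged.
sumBelow-triangle : ∀ n (f : ℕ → ℕ → ℕ) → (∀ m k → m < k → f m k ≡ 0) →
  sumBelow n (λ m → sumTo m (f m)) ≡ sumBelow n (λ k → sumBelow n (λ m → f m k))
sumBelow-triangle zero    f f≡0 = refl
sumBelow-triangle (suc n) f f≡0 = begin
  sumBelow n (λ m → sumTo m (f m)) + sumTo n (f n)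
    ≡⟨ cong₂ _+_ (sumBelow-triangle n f f≡0) (sumTo≡sumBelow n (f n)) ⟩
  columns n + sumBelow (suc n) (f n)
    ≡⟨ cong (_+ sumBelow (suc n) (f n)) (sym (+-identityʳ (columns n))) ⟩
  (columns n + 0) + sumBelow (suc n) (f n)
    -- The new column `k = n` is zero on the rows `m < n`; inserting it turns `columns n` into
    -- `columns (suc n)`.
    ≡⟨ cong (λ z → (columns n + z) + sumBelow (suc n) (f n))
         (sym (sumBelow-zero n (λ m m<n → f≡0 m n m<n))) ⟩
  columns (suc n) + sumBelow (suc n) (f n)
    ≡⟨ sym (sumBelow-+ (suc n) (λ k → sumBelow n (λ m → f m k)) (f n)) ⟩
  sumBelow (suc n) (λ k → sumBelow (suc n) (λ m → f m k)) ∎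
  where
  columns : ℕ → ℕ
  columns N = sumBelow N (λ k → sumBelow n (λ m → f m k))

-- Binomial coefficient identities.

nC0≡1 : ∀ n → n C 0 ≡ 1
nC0≡1 zero    = refl
nC0≡1 (suc n) = refl

pascal : ∀ n k → suc n C suc k ≡ n C k + n C suc k
pascal n k = sym (nCk+nC[k+1]≡[n+1]C[k+1] n k)

absorption : ∀ n k → suc k * (suc n C suc k) ≡ suc n * (n C k)
absorption zero    zero    = refl
absorption zero    (suc k) = *-zeroʳ (suc (suc k))
absorption (suc n) zero    = begin
  1 * (suc (suc n) C 1)        ≡⟨ *-identityˡ _ ⟩
  suc (suc n) C 1              ≡⟨ nC1≡n (suc (suc n)) ⟩
  suc (suc n)                  ≡⟨ sym (*-identityʳ _) ⟩
  suc (suc n) * 1              ≡⟨ cong (λ u → suc (suc n) * u) (sym (nC0≡1 (suc n))) ⟩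
  suc (suc n) * (suc n C 0)    ∎
absorption (suc n) (suc k) = begin
  suc (suc k) * (suc (suc n) C suc (suc k))
    ≡⟨ cong (suc (suc k) *_) (pascal (suc n) (suc k)) ⟩
  suc (suc k) * (x + y)
    ≡⟨ split k x y ⟩
  (suc k * x + x) + suc (suc k) * y
    ≡⟨ cong₂ (λ u v → (u + x) + v) (absorption n k) (absorption n (suc k)) ⟩
  (suc n * (n C k) + x) + suc n * (n C suc k)
    ≡⟨ collect n (n C k) x (n C suc k) ⟩
  x + suc n * (n C k + n C suc k)
    ≡⟨ cong (λ z → x + suc n * z) (sym (pascal n k)) ⟩
  suc (suc n) * x ∎
  where
  x = suc n C suc k
  y = suc n C suc (suc k)
  split : ∀ k x y → suc (suc k) * (x + y) ≡ (suc k * x + x) + suc (suc k) * y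
  split = solve-∀
  collect : ∀ n a x b → (suc n * a + x) + suc n * b ≡ x + suc n * (a + b)
  collect = solve-∀

-- This is (n-k) C(n,k) = (k+1) C(n,k+1) with the subtraction moved across. Adding C(n,k) to both
-- sides reduces it to absorption and Pascal's rule.
n*nCk : ∀ n k → n * (n C k) ≡ suc k * (n C suc k) + k * (n C k)
n*nCk n k = +-cancelˡ-≡ c _ _ (begin
  suc n * c                        ≡⟨ sym (absorption n k) ⟩
  suc k * (suc n C suc k)          ≡⟨ cong (suc k *_) (pascal n k) ⟩
  suc k * (c + c′)                 ≡⟨ expand k c c′ ⟩
  c + (suc k * c′ + k * c)         ∎)
  where
  c = n C k
  c′ = n C suc k
  expand : ∀ k c c′ → suc k * (c + c′) ≡ c + (suc k * c′ + k * c)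
  expand = solve-∀

hockeyStick : ∀ n k → sumBelow n (λ i → i C k) ≡ n C suc k
hockeyStick zero    k = refl
hockeyStick (suc n) k = begin
  sumBelow n (λ i → i C k) + n C k  ≡⟨ cong (_+ n C k) (hockeyStick n k) ⟩
  n C suc k + n C k                 ≡⟨ +-comm (n C suc k) (n C k) ⟩
  n C k + n C suc k                 ≡⟨ sym (pascal n k) ⟩
  suc n C suc k                     ∎

-- Half of C(2k+2,k+1). It links two consecutive central coefficients without division, through
-- `[k+1]*centralHalf` and `2*centralHalf`.
centralHalf : ℕ → ℕ
centralHalf k = suc (2 * k) C suc k

[k+1]*centralHalf : ∀ k → suc k * centralHalf k ≡ (2 * k + 1) * ((2 * k) C k)
[k+1]*centralHalf k = trans (absorption (2 * k) k) (cong (_* ((2 * k) C k)) (+-comm 1 (2 * k)))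

2*centralHalf : ∀ k → (2 * suc k) C suc k ≡ 2 * centralHalf k
2*centralHalf k = begin
  (2 * suc k) C suc k                        ≡⟨ cong (_C suc k) (double k) ⟩
  suc (suc (2 * k)) C suc k                  ≡⟨ pascal (suc (2 * k)) k ⟩
  suc (2 * k) C k + centralHalf k            ≡⟨ cong (_+ centralHalf k) reflect ⟩
  centralHalf k + centralHalf k              ≡⟨ cong (λ z → centralHalf k + z) (sym (+-identityʳ _)) ⟩
  2 * centralHalf k                          ∎
  where
  double : ∀ k → 2 * suc k ≡ suc (suc (2 * k))
  double = solve-∀
  split : ∀ k → suc (2 * k) ≡ k + suc k
  split = solve-∀
  reflect : suc (2 * k) C k ≡ centralHalf k
  reflect = trans
    (nCk≡nC[n∸k] (subst (k ≤_) (sym (split k)) (m≤m+n k (suc k))))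
    (cong (suc (2 * k) C_) (trans (cong (_∸ k) (split k)) (m+n∸m≡n k (suc k))))

-- Sums of squared binomial coefficients over the upper index.

squareSum : ℕ → ℕ → ℕ
squareSum n k = sumBelow n (λ m → (m C k) * (m C k))

weightedSquareSum : ℕ → ℕ → ℕ
weightedSquareSum n k = sumBelow n (λ m → m * ((m C k) * (m C k)))

squareSum-diagonal : ∀ n → squareSum n n ≡ 0
squareSum-diagonal n = sumBelow-zero n (λ m m<n → cong₂ _*_ (k>n⇒nCk≡0 m<n) (k>n⇒nCk≡0 m<n))

-- Induction on `n`: the increments of the two sides are polynomials in `n`, `k`, C(n,k) and
-- C(n,k+1), and they agree once n C(n,k) is eliminated by `n*nCk`.
squareSum-rec : ∀ n k →
  suc k * squareSum n k + 2 * n * ((n C suc k) * (n C suc k))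
    ≡ 2 * (2 * k + 3) * squareSum n (suc k) + 3 * suc k * ((n C suc k) * (n C suc k))
squareSum-rec zero    k = base k
  where
  base : ∀ k → suc k * 0 + 0 ≡ 2 * (2 * k + 3) * 0 + 3 * suc k * 0
  base = solve-∀
squareSum-rec (suc n) k rewrite pascal n k = begin
  suc k * (Q + c * c) + 2 * suc n * ((c + c′) * (c + c′))
    -- Apart from the term 2n c′² wanted by the induction hypothesis, every occurrence of `n` is
    -- gathered into the product `n * c`, ready for `n*nCk`.
    ≡⟨ isolate k n Q c c′ ⟩
  (suc k * Q + 2 * n * (c′ * c′))
    + (suc k * (c * c) + 2 * ((c + c′) * (c + c′)) + 2 * (c + 2 * c′) * (n * c))
    ≡⟨ cong₂ (λ u v → u + (suc k * (c * c) + 2 * ((c + c′) * (c + c′)) + 2 * (c + 2 * c′) * v))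
         (squareSum-rec n k) (n*nCk n k) ⟩
  (2 * (2 * k + 3) * Q′ + 3 * suc k * (c′ * c′))
    + (suc k * (c * c) + 2 * ((c + c′) * (c + c′)) + 2 * (c + 2 * c′) * (suc k * c′ + k * c))
    ≡⟨ collect k Q′ c c′ ⟩
  2 * (2 * k + 3) * (Q′ + c′ * c′) + 3 * suc k * ((c + c′) * (c + c′)) ∎
  where
  c = n C k
  c′ = n C suc k
  Q = squareSum n k
  Q′ = squareSum n (suc k)
  isolate : ∀ k n Q c c′ →
    suc k * (Q + c * c) + 2 * suc n * ((c + c′) * (c + c′))
      ≡ (suc k * Q + 2 * n * (c′ * c′))
        + (suc k * (c * c) + 2 * ((c + c′) * (c + c′)) + 2 * (c + 2 * c′) * (n * c))
  isolate = solve-∀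
  collect : ∀ k Q′ c c′ →
    (2 * (2 * k + 3) * Q′ + 3 * suc k * (c′ * c′))
      + (suc k * (c * c) + 2 * ((c + c′) * (c + c′)) + 2 * (c + 2 * c′) * (suc k * c′ + k * c))
      ≡ 2 * (2 * k + 3) * (Q′ + c′ * c′) + 3 * suc k * ((c + c′) * (c + c′))
  collect = solve-∀

-- Expresses the first moment through `squareSum` and one boundary square, again by induction on `n`
-- with `n*nCk`. Later it removes the factor m from the sum of m S_m.
weightedSquareSum-eq : ∀ n k →
  2 * weightedSquareSum n k + squareSum n k
    ≡ k * squareSum n k + suc k * ((n C suc k) * (n C suc k))
weightedSquareSum-eq zero    k = base k
  where
  base : ∀ k → 0 ≡ k * 0 + suc k * 0
  base = solve-∀
weightedSquareSum-eq (suc n) k rewrite pascal n k = begin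
  2 * (R + n * (c * c)) + (Q + c * c)
    ≡⟨ isolate n R Q c ⟩
  (2 * R + Q) + (2 * c * (n * c) + c * c)
    ≡⟨ cong₂ (λ u v → u + (2 * c * v + c * c)) (weightedSquareSum-eq n k) (n*nCk n k) ⟩
  (k * Q + suc k * (c′ * c′)) + (2 * c * (suc k * c′ + k * c) + c * c)
    ≡⟨ collect k Q c c′ ⟩
  k * (Q + c * c) + suc k * ((c + c′) * (c + c′)) ∎
  where
  c = n C k
  c′ = n C suc k
  Q = squareSum n k
  R = weightedSquareSum n k
  isolate : ∀ n R Q c →
    2 * (R + n * (c * c)) + (Q + c * c) ≡ (2 * R + Q) + (2 * c * (n * c) + c * c)
  isolate = solve-∀
  collect : ∀ k Q c c′ →
    (k * Q + suc k * (c′ * c′)) + (2 * c * (suc k * c′ + k * c) + c * c)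
      ≡ k * (Q + c * c) + suc k * ((c + c′) * (c + c′))
  collect = solve-∀

-- The weights and summation by parts.

weight : ℕ → ℕ → ℕ
weight n k = ((2 * k) C k) * (2 * k + 1) * squareSum n k

-- Multiply `squareSum-rec` by (k+1) `centralHalf k`. With N = n+1, both boundary terms become
-- multiples of N² because (k+1) C(N,k+1) = N C(n,k): it is used once where a factor N is already
-- present, and twice in the other term. The two witnesses are the resulting cofactors.
weight-step : ∀ n k → suc k * weight (suc n) k ≡ suc k * weight (suc n) (suc k) [mod suc n * suc n ]
weight-step n k = congruent (2 * B * (n C k) * c′) (3 * B * ((n C k) * (n C k))) (begin
  suc k * (((2 * k) C k) * (2 * k + 1) * Q) + suc n * suc n * (2 * B * (n C k) * c′)
    ≡⟨ pullOut k ((2 * k) C k) Q n B (n C k) c′ ⟩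
  suc k * ((2 * k + 1) * ((2 * k) C k)) * Q + 2 * B * suc n * c′ * (suc n * (n C k))
    ≡⟨ cong₂ (λ u v → suc k * u * Q + 2 * B * suc n * c′ * v)
         (sym ([k+1]*centralHalf k)) (sym (absorption n k)) ⟩
  suc k * (suc k * B) * Q + 2 * B * suc n * c′ * (suc k * c′)
    ≡⟨ factor k B Q n c′ ⟩
  suc k * B * (suc k * Q + 2 * suc n * (c′ * c′))
    ≡⟨ cong (λ u → suc k * B * u) (squareSum-rec (suc n) k) ⟩
  suc k * B * (2 * (2 * k + 3) * Q′ + 3 * suc k * (c′ * c′))
    ≡⟨ unfactor k B Q′ c′ ⟩
  suc k * (2 * B * (2 * suc k + 1) * Q′) + 3 * B * ((suc k * c′) * (suc k * c′))
    ≡⟨ cong₂ (λ u v → suc k * (u * (2 * suc k + 1) * Q′) + 3 * B * (v * v))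
         (sym (2*centralHalf k)) (absorption n k) ⟩
  suc k * weight (suc n) (suc k) + 3 * B * ((suc n * (n C k)) * (suc n * (n C k)))
    ≡⟨ cong (λ u → suc k * weight (suc n) (suc k) + u) (pushIn n B (n C k)) ⟩
  suc k * weight (suc n) (suc k) + suc n * suc n * (3 * B * ((n C k) * (n C k))) ∎)
  where
  B = centralHalf k
  c′ = suc n C suc k
  Q = squareSum (suc n) k
  Q′ = squareSum (suc n) (suc k)
  pullOut : ∀ k z Q n B c c′ →
    suc k * (z * (2 * k + 1) * Q) + suc n * suc n * (2 * B * c * c′)
      ≡ suc k * ((2 * k + 1) * z) * Q + 2 * B * suc n * c′ * (suc n * c)
  pullOut = solve-∀
  factor : ∀ k B Q n c′ →
    suc k * (suc k * B) * Q + 2 * B * suc n * c′ * (suc k * c′)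
      ≡ suc k * B * (suc k * Q + 2 * suc n * (c′ * c′))
  factor = solve-∀
  unfactor : ∀ k B Q′ c′ →
    suc k * B * (2 * (2 * k + 3) * Q′ + 3 * suc k * (c′ * c′))
      ≡ suc k * (2 * B * (2 * suc k + 1) * Q′) + 3 * B * ((suc k * c′) * (suc k * c′))
  unfactor = solve-∀
  pushIn : ∀ n B c → 3 * B * ((suc n * c) * (suc n * c)) ≡ suc n * suc n * (3 * B * (c * c))
  pushIn = solve-∀

-- With D_k the sum of `d` below k, the induction maintains a D_N w_N as the value of the partial
-- sum. Adding the next term gives a D_{N+1} w_N, and w_N must then become w_{N+1}. Since k+1 need
-- not be invertible modulo `q`, this replacement relies on a D_{N+1} being a multiple of N+1.
summation-by-parts : ∀ {q} a (d w : ℕ → ℕ) →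
  (∀ k → k ℕ∣.∣ a * sumBelow k d) →
  (∀ k → suc k * w k ≡ suc k * w (suc k) [mod q ]) →
  ∀ N → a * sumBelow N (λ k → w k * d k) ≡ a * sumBelow N d * w N [mod q ]
summation-by-parts a d w k∣ad w-step zero    =
  ≡⇒≡mod (trans (*-zeroʳ a) (cong (_* w 0) (sym (*-zeroʳ a))))
summation-by-parts a d w k∣ad w-step (suc N) =
  ≡mod-trans (≡⇒≡mod (*-distribˡ-+ a (sumBelow N (λ k → w k * d k)) (w N * d N)))
  (≡mod-trans (≡mod-+ (summation-by-parts a d w k∣ad w-step N) (≡⇒≡mod {a = a * (w N * d N)} refl))
  (≡mod-trans (≡⇒≡mod (collect a (sumBelow N d) (w N) (d N))) advance))
  where
  collect : ∀ a s w d → a * s * w + a * (w * d) ≡ a * (s + d) * w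
  collect = solve-∀
  advance : a * sumBelow (suc N) d * w N ≡ a * sumBelow (suc N) d * w (suc N) [mod _ ]
  -- Writing a D_{N+1} = e (N+1) exposes the factor N+1 under which `w-step` applies.
  advance with k∣ad (suc N)
  ... | divides e eq rewrite eq =
    ≡mod-trans (≡⇒≡mod (*-assoc e (suc N) (w N)))
    (≡mod-trans (≡mod-*ˡ e (w-step N)) (≡⇒≡mod (sym (*-assoc e (suc N) (w (suc N))))))

-- Divisibility of sums of odd powers.

-- (2i+1) C(i,j) = (2j+1) C(i,j) + 2(j+1) C(i,j+1), and (j+1) Σ_{i<k} C(i,j) = k C(k-1,j).
multiplier : ℕ → ℕ → ℕ
multiplier zero    j = suc j
multiplier (suc s) j = multiplier s j * multiplier s (suc j)

multiplier≢0 : ∀ s j → NonZero (multiplier s j)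
multiplier≢0 zero    j = _
multiplier≢0 (suc s) j =
  m*n≢0 (multiplier s j) (multiplier s (suc j)) {{multiplier≢0 s j}} {{multiplier≢0 s (suc j)}}

oddPower-binomial : ∀ s i j →
  (2 * i + 1) ^ suc s * (i C j)
    ≡ (2 * j + 1) * ((2 * i + 1) ^ s * (i C j)) + 2 * suc j * ((2 * i + 1) ^ s * (i C suc j))
oddPower-binomial s i j = begin
  (2 * i + 1) * p * c                          ≡⟨ isolate i p c ⟩
  p * (2 * (i * c) + c)                        ≡⟨ cong (λ z → p * (2 * z + c)) (n*nCk i j) ⟩
  p * (2 * (suc j * c′ + j * c) + c)           ≡⟨ collect j p c c′ ⟩
  (2 * j + 1) * (p * c) + 2 * suc j * (p * c′) ∎
  where
  p = (2 * i + 1) ^ s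
  c = i C j
  c′ = i C suc j
  isolate : ∀ i p c → (2 * i + 1) * p * c ≡ p * (2 * (i * c) + c)
  isolate = solve-∀
  collect : ∀ j p c c′ →
    p * (2 * (suc j * c′ + j * c) + c) ≡ (2 * j + 1) * (p * c) + 2 * suc j * (p * c′)
  collect = solve-∀

-- The factor C(i,j) is what makes induction on `s` possible: removing one factor 2i+1 leaves sums
-- with lower indices j and j+1, so the product of their multipliers serves for both. At exponent
-- zero, the hockey-stick identity and absorption give the quotient.
k∣multiplier*sum-binomial : ∀ s j k →
  k ℕ∣.∣ multiplier s j * sumBelow k (λ i → (2 * i + 1) ^ s * (i C j))
k∣multiplier*sum-binomial s       j zero    = divides 0 (*-zeroʳ (multiplier s j))
k∣multiplier*sum-binomial zero    j (suc k) = divides (k C j) (begin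
  suc j * sumBelow (suc k) (λ i → 1 * (i C j))
    ≡⟨ cong (suc j *_) (sumBelow-cong (suc k) (λ i → *-identityˡ (i C j))) ⟩
  suc j * sumBelow (suc k) (λ i → i C j)  ≡⟨ cong (suc j *_) (hockeyStick (suc k) j) ⟩
  suc j * (suc k C suc j)                 ≡⟨ absorption k j ⟩
  suc k * (k C j)                         ≡⟨ *-comm (suc k) (k C j) ⟩
  (k C j) * suc k                         ∎)
k∣multiplier*sum-binomial (suc s) j k@(suc _) = subst (k ℕ∣.∣_) (sym split)
  (∣m∣n⇒∣m+n (∣n⇒∣m*n (b * (2 * j + 1)) (k∣multiplier*sum-binomial s j k))
             (∣n⇒∣m*n (a * (2 * suc j)) (k∣multiplier*sum-binomial s (suc j) k)))
  where
  a = multiplier s j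
  b = multiplier s (suc j)
  f g : ℕ → ℕ
  f i = (2 * i + 1) ^ s * (i C j)
  g i = (2 * i + 1) ^ s * (i C suc j)
  distribute : ∀ a b u v x y →
    a * b * (u * x + v * y) ≡ b * u * (a * x) + a * v * (b * y)
  distribute = solve-∀
  split : a * b * sumBelow k (λ i → (2 * i + 1) ^ suc s * (i C j))
    ≡ b * (2 * j + 1) * (a * sumBelow k f) + a * (2 * suc j) * (b * sumBelow k g)
  split = begin
    a * b * sumBelow k (λ i → (2 * i + 1) ^ suc s * (i C j))
      ≡⟨ cong (λ u → a * b * u) (sumBelow-cong k (λ i → oddPower-binomial s i j)) ⟩
    a * b * sumBelow k (λ i → (2 * j + 1) * f i + 2 * suc j * g i)
      ≡⟨ cong (λ u → a * b * u) (sumBelow-+ k (λ i → (2 * j + 1) * f i) (λ i → 2 * suc j * g i)) ⟩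
    a * b * (sumBelow k (λ i → (2 * j + 1) * f i) + sumBelow k (λ i → 2 * suc j * g i))
      ≡⟨ cong (λ u → a * b * u) (cong₂ _+_ (sumBelow-*ˡ k (2 * j + 1) f) (sumBelow-*ˡ k (2 * suc j) g)) ⟩
    a * b * ((2 * j + 1) * sumBelow k f + 2 * suc j * sumBelow k g)
      ≡⟨ distribute a b (2 * j + 1) (2 * suc j) (sumBelow k f) (sumBelow k g) ⟩
    b * (2 * j + 1) * (a * sumBelow k f) + a * (2 * suc j) * (b * sumBelow k g) ∎

k∣multiplier*sum-oddPower : ∀ s k → k ℕ∣.∣ multiplier s 0 * sumBelow k (λ i → (2 * i + 1) ^ s)
k∣multiplier*sum-oddPower s k = subst (λ z → k ℕ∣.∣ multiplier s 0 * z)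
  (sumBelow-cong k (λ i → trans (cong ((2 * i + 1) ^ s *_) (nC0≡1 i)) (*-identityʳ _)))
  (k∣multiplier*sum-binomial s 0 k)

-- Rewriting the sums of S_m column by column.

summand-zero : ∀ s m k → m < k → (m C k) * (m C k) * ((2 * k) C k) * (2 * k + 1) ^ s ≡ 0
summand-zero s m k m<k rewrite k>n⇒nCk≡0 m<k = refl

sum-S : ∀ s n →
  sumBelow n (S s) ≡ sumBelow n (λ k → ((2 * k) C k) * (2 * k + 1) ^ s * squareSum n k)
sum-S s n = trans
  (sumBelow-triangle n (λ m k → (m C k) * (m C k) * ((2 * k) C k) * (2 * k + 1) ^ s) (summand-zero s))
  (sumBelow-cong n (λ k → trans
    (sumBelow-cong n (λ m → rearrange ((m C k) * (m C k)) ((2 * k) C k) ((2 * k + 1) ^ s)))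
    (sumBelow-*ˡ n (((2 * k) C k) * (2 * k + 1) ^ s) (λ m → (m C k) * (m C k)))))
  where
  rearrange : ∀ x z p → x * z * p ≡ z * p * x
  rearrange = solve-∀

*-distribˡ-sumTo : ∀ m c f → c * sumTo m f ≡ sumTo m (λ k → c * f k)
*-distribˡ-sumTo zero    c f = refl
*-distribˡ-sumTo (suc m) c f = trans
  (*-distribˡ-+ c (sumTo m f) (f (suc m))) (cong (_+ c * f (suc m)) (*-distribˡ-sumTo m c f))

sum-mS : ∀ s n →
  sumBelow n (λ m → m * S s m)
    ≡ sumBelow n (λ k → ((2 * k) C k) * (2 * k + 1) ^ s * weightedSquareSum n k)
sum-mS s n = trans (sumBelow-cong n (λ m → *-distribˡ-sumTo m m _)) (trans
  (sumBelow-triangle n (λ m k → m * ((m C k) * (m C k) * ((2 * k) C k) * (2 * k + 1) ^ s))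
    (λ m k m<k → trans (cong (m *_) (summand-zero s m k m<k)) (*-zeroʳ m)))
  (sumBelow-cong n (λ k → trans
    (sumBelow-cong n (λ m → rearrange m ((m C k) * (m C k)) ((2 * k) C k) ((2 * k + 1) ^ s)))
    (sumBelow-*ˡ n (((2 * k) C k) * (2 * k + 1) ^ s) (λ m → m * ((m C k) * (m C k)))))))
  where
  rearrange : ∀ m x z p → m * (x * z * p) ≡ z * p * (m * x)
  rearrange = solve-∀

-- Divisibility of the plain and weighted sums.

-- One factor 2k+1 of the power belongs to `weight`, so only (2k+1)^s is summed by parts and the
-- multiplier is the one for exponent `s`.
n²∣sum-S : ∀ s n → suc n * suc n ℕ∣.∣ multiplier s 0 * sumBelow (suc n) (S (suc s))
n²∣sum-S s n = ∣-≡mod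
  (≡mod-trans (≡⇒≡mod (cong (a *_) (trans (sum-S (suc s) N) (sumBelow-cong N regroup))))
    (summation-by-parts a d (weight N) (k∣multiplier*sum-oddPower s) (weight-step n) N))
  -- The boundary term left by summation by parts contains `weight N N`, which is zero.
  (∣n⇒∣m*n (a * sumBelow N d) (divides 0 weight-diagonal))
  where
  N = suc n
  a = multiplier s 0
  d : ℕ → ℕ
  d i = (2 * i + 1) ^ s
  rearrange : ∀ z x p Q → z * (x * p) * Q ≡ z * x * Q * p
  rearrange = solve-∀
  regroup : ∀ k → ((2 * k) C k) * (2 * k + 1) ^ suc s * squareSum N k ≡ weight N k * d k
  regroup k = rearrange ((2 * k) C k) (2 * k + 1) (d k) (squareSum N k)
  weight-diagonal : weight N N ≡ 0
  weight-diagonal = trans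
    (cong (λ u → ((2 * N) C N) * (2 * N + 1) * u) (squareSum-diagonal N))
    (*-zeroʳ (((2 * N) C N) * (2 * N + 1)))

-- For a fixed column, with Q and R the plain and weighted square sums, 4R + 3Q = 2(2R+Q) + Q =
-- (2k+1) Q + 2(k+1) C(N,k+1)². The first term raises the exponent by one; the second contributes a
-- multiple of N².
sum-mS≡sum-S : ∀ s n →
  4 * sumBelow (suc n) (λ m → m * S (suc s) m) + 3 * sumBelow (suc n) (S (suc s))
    ≡ sumBelow (suc n) (S (suc (suc s))) [mod suc n * suc n ]
sum-mS≡sum-S s n = ≡mod-trans (≡⇒≡mod merge)
  (≡mod-trans (sumBelow-≡mod N pointwise) (≡⇒≡mod (sym (sum-S (suc (suc s)) N))))
  where
  N = suc n
  g : ℕ → ℕ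
  g k = ((2 * k) C k) * (2 * k + 1) ^ suc s
  merge : 4 * sumBelow N (λ m → m * S (suc s) m) + 3 * sumBelow N (S (suc s))
    ≡ sumBelow N (λ k → 4 * (g k * weightedSquareSum N k) + 3 * (g k * squareSum N k))
  merge = begin
    4 * sumBelow N (λ m → m * S (suc s) m) + 3 * sumBelow N (S (suc s))
      ≡⟨ cong₂ (λ u v → 4 * u + 3 * v) (sum-mS (suc s) N) (sum-S (suc s) N) ⟩
    4 * sumBelow N (λ k → g k * weightedSquareSum N k) + 3 * sumBelow N (λ k → g k * squareSum N k)
      ≡⟨ sym (cong₂ _+_ (sumBelow-*ˡ N 4 _) (sumBelow-*ˡ N 3 _)) ⟩
    sumBelow N (λ k → 4 * (g k * weightedSquareSum N k)) + sumBelow N (λ k → 3 * (g k * squareSum N k))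
      ≡⟨ sym (sumBelow-+ N _ _) ⟩
    sumBelow N (λ k → 4 * (g k * weightedSquareSum N k) + 3 * (g k * squareSum N k)) ∎
  pointwise : ∀ k → 4 * (g k * weightedSquareSum N k) + 3 * (g k * squareSum N k)
    ≡ ((2 * k) C k) * (2 * k + 1) ^ suc (suc s) * squareSum N k [mod N * N ]
  pointwise k = congruent 0 (2 * B * p * (c * c)) (begin
    4 * (z * (x * p) * R) + 3 * (z * (x * p) * Q) + N * N * 0
      ≡⟨ isolate z x p R Q N ⟩
    z * (x * p) * (2 * (2 * R + Q) + Q)
      ≡⟨ cong (λ u → z * (x * p) * (2 * u + Q)) (weightedSquareSum-eq N k) ⟩
    z * (x * p) * (2 * (k * Q + suc k * (c′ * c′)) + Q)
      ≡⟨ separate k z p Q c′ ⟩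
    z * (x * (x * p)) * Q + 2 * p * (x * z) * suc k * (c′ * c′)
      -- A factor 2k+1, available because the exponent is positive, combines with C(2k,k) to supply
      -- the second k+1; then (k+1)² C(N,k+1)² = N² C(n,k)².
      ≡⟨ cong (λ u → z * (x * (x * p)) * Q + 2 * p * u * suc k * (c′ * c′)) (sym ([k+1]*centralHalf k)) ⟩
    z * (x * (x * p)) * Q + 2 * p * (suc k * B) * suc k * (c′ * c′)
      ≡⟨ cong (λ u → z * (x * (x * p)) * Q + u) (pair k p B c′) ⟩
    z * (x * (x * p)) * Q + 2 * p * B * ((suc k * c′) * (suc k * c′))
      ≡⟨ cong (λ u → z * (x * (x * p)) * Q + 2 * p * B * (u * u)) (absorption n k) ⟩
    z * (x * (x * p)) * Q + 2 * p * B * ((N * c) * (N * c))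
      ≡⟨ cong (λ u → z * (x * (x * p)) * Q + u) (pushIn N p B c) ⟩
    z * (x * (x * p)) * Q + N * N * (2 * B * p * (c * c)) ∎)
    where
    z = (2 * k) C k
    x = 2 * k + 1
    p = (2 * k + 1) ^ s
    B = centralHalf k
    c = n C k
    c′ = N C suc k
    Q = squareSum N k
    R = weightedSquareSum N k
    isolate : ∀ z x p R Q N →
      4 * (z * (x * p) * R) + 3 * (z * (x * p) * Q) + N * N * 0 ≡ z * (x * p) * (2 * (2 * R + Q) + Q)
    isolate = solve-∀
    separate : ∀ k z p Q c′ →
      z * ((2 * k + 1) * p) * (2 * (k * Q + suc k * (c′ * c′)) + Q)
        ≡ z * ((2 * k + 1) * ((2 * k + 1) * p)) * Q + 2 * p * ((2 * k + 1) * z) * suc k * (c′ * c′)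
    separate = solve-∀
    pair : ∀ k p B c′ →
      2 * p * (suc k * B) * suc k * (c′ * c′) ≡ 2 * p * B * ((suc k * c′) * (suc k * c′))
    pair = solve-∀
    pushIn : ∀ N p B c → 2 * p * B * ((N * c) * (N * c)) ≡ N * N * (2 * B * p * (c * c))
    pushIn = solve-∀

-- The preceding congruence is multiplied by both multipliers: one handles exponent s+1, the other
-- exponent s+2. Cancelling the plain sum leaves the coefficient 4.
n²∣sum-mS : ∀ s n →
  suc n * suc n ℕ∣.∣
    4 * (multiplier s 0 * multiplier (suc s) 0) * sumBelow (suc n) (λ m → m * S (suc s) m)
n²∣sum-mS s n = ∣m+n∣m⇒∣n
  (subst (suc n * suc n ℕ∣.∣_) (distribute a b M A)
    (∣-≡mod (≡mod-*ˡ (a * b) (sum-mS≡sum-S s n))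
      (subst (suc n * suc n ℕ∣.∣_) (sym (*-assoc a b _)) (∣n⇒∣m*n a (n²∣sum-S (suc s) n)))))
  (∣n⇒∣m*n (3 * b) (n²∣sum-S s n))
  where
  a = multiplier s 0
  b = multiplier (suc s) 0
  A = sumBelow (suc n) (S (suc s))
  M = sumBelow (suc n) (λ m → m * S (suc s) m)
  distribute : ∀ a b M A → a * b * (4 * M + 3 * A) ≡ 3 * b * (a * A) + 4 * (a * b) * M
  distribute = solve-∀

-- Transfer to the integers.

-- Integer divisibility is divisibility of absolute values, and these are multiplicative.
∣⇒+∣+ : ∀ {q} a x → q ℕ∣.∣ a * x → + q ∣ + a Data.Integer.* + x
∣⇒+∣+ {q} a x = subst (q ℕ∣.∣_) (sym (abs-* (+ a) (+ x)))

NonZero⇒+≢0 : ∀ m → NonZero m → + m ≢ 0ℤ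
NonZero⇒+≢0 m m≢0 +m≡0 = ≢-nonZero⁻¹ m {{m≢0}} (+-injective +m≡0)

theorem1p4 : (r : ℕ) → .{{_ : NonZero r}} →
    Σ ℤ λ a → Σ ℤ λ b → a ≢ 0ℤ × b ≢ 0ℤ ×
    ((n : ℕ) → .{{_ : NonZero n}} →
    (+ (n * n) ∣ a Data.Integer.* + sumBelow n (λ k → S (2 * r ∸ 1) k))
    × (+ (n * n) ∣ b Data.Integer.* + sumBelow n (λ k → k * S r k)))
theorem1p4 (suc r) =
  + a , + b , NonZero⇒+≢0 a (multiplier≢0 (r + r) 0) ,
  NonZero⇒+≢0 b (m*n≢0 4 _ {{_}} {{m*n≢0 (multiplier r 0) (multiplier (suc r) 0)
    {{multiplier≢0 r 0}} {{multiplier≢0 (suc r) 0}}}}) ,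
  λ { (suc n) →
      subst (λ e → + (suc n * suc n) ∣ + a Data.Integer.* + sumBelow (suc n) (S e)) (sym exponent)
        (∣⇒+∣+ a _ (n²∣sum-S (r + r) n))
    , ∣⇒+∣+ b _ (n²∣sum-mS r n) }
  where
  -- Here `r` is the predecessor of the given index, so the odd exponent is `suc (r + r)`; `weight`
  -- takes one factor and `r + r` remains.
  a = multiplier (r + r) 0
  b = 4 * (multiplier r 0 * multiplier (suc r) 0)
  exponent : 2 * suc r ∸ 1 ≡ suc (r + r)
  exponent = trans (cong (λ z → r + suc z) (+-identityʳ r)) (+-suc r r)
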